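{- Let $\Gamma\cup\{\varphi\}\subseteq For(\Sigma)$. If $\Gamma\models_{\mathbb{BI}}\varphi$ then $\Gamma\vdash_{\mathbf{RmbC}}\varphi$.
   Context: Let $\Sigma=\{\wedge,\vee,\to,\neg,\circ\}$ ($\neg,\circ$ unary, the others binary) and let $For(\Sigma)$ be the algebra of formulas over $\Sigma$ generated by a denumerable set $\mathcal V$ of propositional variables. $\alpha\leftrightarrow\beta$ abbreviates $(\alpha\to\beta)\wedge(\beta\to\alpha)$. $\mathbf{RmbC}$ is the Hilbert calculus with axiom schemas: (Ax1) $\alpha\to(\beta\to\alpha)$; (Ax2) $(\alpha\to(\beta\to\gamma))\to((\alpha\to\beta)\to(\alpha\to\gamma))$; (Ax3) $\alpha\to(\beta\to(\alpha\wedge\beta))$; (Ax4) $(\alpha\wedge\beta)\to\alpha$; (Ax5) $(\alpha\wedge\beta)\to\beta$; (Ax6) $\alpha\to(\alpha\vee\beta)$; (Ax7) $\beta\to(\alpha\vee\beta)$; (Ax8) $(\alpha\to\gamma)\to((\beta\to\gamma)\to((\alpha\vee\beta)\to\gamma))$; (Ax9) $(\alpha\to\beta)\vee\alpha$; (Ax10) $\alpha\vee\neg\alpha$; (bc1) $\circ\alpha\to(\alpha\to(\neg\alpha\to\beta))$; and rules: (MP) from $\alpha$ and $\alpha\to\beta$ infer $\beta$; $(\mathbf R_\neg)$ from $\alpha\leftrightarrow\beta$ infer $\neg\alpha\leftrightarrow\neg\beta$; $(\mathbf R_\circ)$ from $\alpha\leftrightarrow\beta$ infer $\circ\alpha\leftrightarrow\circ\beta$.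 A formula $\varphi$ is a theorem ($\vdash_{\mathbf{RmbC}}\varphi$) if there is a finite sequence of formulas ending in $\varphi$ each of which is an instance of an axiom schema or follows from earlier formulas of the sequence by a rule. $\Gamma\vdash_{\mathbf{RmbC}}\varphi$ means that either $\vdash_{\mathbf{RmbC}}\varphi$ or there is a finite non-empty $\{\gamma_1,\dots,\gamma_n\}\subseteq\Gamma$ with $\vdash_{\mathbf{RmbC}}(\gamma_1\wedge(\gamma_2\wedge(\cdots\wedge(\gamma_{n-1}\wedge\gamma_n)\cdots)))\to\varphi$. A Boolean algebra with LFI operators (BALFI) is an algebra $\mathcal B=\langle A,\wedge,\vee,\to,\neg,\circ,0,1\rangle$ such that $\langle A,\wedge,\vee,\to,0,1\rangle$ is a Boolean algebra (with $a\to b$ the Boolean implication) and the unary operations $\neg,\circ$ satisfy $a\vee\neg a=1$ and $a\wedge\neg a\wedge\circ a=0$ for all $a\in A$. $\mathbb{BI}$ is the class of BALFIs. A valuation over $\mathcal B$ is a $\Sigma$-homomorphism $v:For(\Sigma)\to\mathcal B$. $\models_{\mathbb{BI}}\varphi$ means $v(\varphi)=1$ for every BALFI $\mathcal B$ and every valuation $v$ over it. $\Gamma\models_{\mathbb{BI}}\varphi$ means that either $\models_{\mathbb{BI}}\varphi$ or there is a finite non-empty $\{\gamma_1,\dots,\gamma_n\}\subseteq\Gamma$ such that $\bigwedge_{i=1}^n v(\gamma_i)\le v(\varphi)$ for every BALFI $\mathcal B$ and every valuation $v$ over it. -}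

module Defs where

open import Level using (0ℓ; _⊔_) renaming (suc to lsuc)
open import Data.Nat.Base using (ℕ)
open import Data.Product.Base using (_×_; ∃)
open import Data.Sum.Base using (_⊎_)
open import Data.List.Base using (List; []; _∷_)
open import Data.List.Membership.Propositional using () renaming (_∈_ to _∈ˡ_)
open import Data.List.NonEmpty.Base using (List⁺; foldr₁; map)
open import Data.List.NonEmpty.Relation.Unary.All using (All)
open import Relation.Binary.Core using (Rel)
open import Relation.Unary using (Pred; _∈_)
open import Algebra.Core using (Op₁; Op₂)
open import Algebra.Definitions using (Congruent₁)
open import Algebra.Lattice.Structures using (IsBooleanAlgebra)
import Relation.Binary.Construct.NaturalOrder.Left as NaturalOrder

-- As in the library's algebraic hierarchy, algebras are taken over setoids,
-- so that ¬ and ∘ are explicitly required to respect the equality.  The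
-- signature has no separate Boolean complement: it is a ⇒ 0#, and ⇒-def then
-- says that ⇒ is the Boolean implication.  The operation ¬ is the
-- paraconsistent negation, which is not in general the Boolean complement.
record BALFI c ℓ : Set (lsuc (c ⊔ ℓ)) where
  infix  8 ¬_ ∘_
  infixr 7 _∧_
  infixr 6 _∨_
  infixr 5 _⇒_
  infix  4 _≈_ _≤_
  field
    Carrier          : Set c
    _≈_              : Rel Carrier ℓ
    _∧_ _∨_ _⇒_      : Op₂ Carrier
    ¬_ ∘_            : Op₁ Carrier
    0# 1#            : Carrier
    isBooleanAlgebra : IsBooleanAlgebra _≈_ _∨_ _∧_ (λ a → a ⇒ 0#) 1# 0#
    ⇒-def            : ∀ a b → (a ⇒ b) ≈ ((a ⇒ 0#) ∨ b)
    ¬-cong           : Congruent₁ _≈_ ¬_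
    ∘-cong           : Congruent₁ _≈_ ∘_
    ∨-¬              : ∀ a → (a ∨ ¬ a) ≈ 1#
    ∧-¬-∘            : ∀ a → (a ∧ ¬ a ∧ ∘ a) ≈ 0#

  -- a ≤ b  is  a ≈ a ∧ b
  _≤_ : Rel Carrier ℓ
  _≤_ = NaturalOrder._≤_ _≈_ _∧_

infix  8 ¬_ ∘_
infixr 7 _∧_
infixr 6 _∨_
infixr 5 _⇒_
infix  4 _⇔_

data Formula : Set where
  var         : ℕ → Formula
  _∧_ _∨_ _⇒_ : Formula → Formula → Formula
  ¬_ ∘_       : Formula → Formula

_⇔_ : Formula → Formula → Formula
α ⇔ β = (α ⇒ β) ∧ (β ⇒ α)

data Axiom : Formula → Set where
  ax1  : ∀ α β   → Axiom (α ⇒ (β ⇒ α))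
  ax2  : ∀ α β γ → Axiom ((α ⇒ (β ⇒ γ)) ⇒ ((α ⇒ β) ⇒ (α ⇒ γ)))
  ax3  : ∀ α β   → Axiom (α ⇒ (β ⇒ (α ∧ β)))
  ax4  : ∀ α β   → Axiom ((α ∧ β) ⇒ α)
  ax5  : ∀ α β   → Axiom ((α ∧ β) ⇒ β)
  ax6  : ∀ α β   → Axiom (α ⇒ (α ∨ β))
  ax7  : ∀ α β   → Axiom (β ⇒ (α ∨ β))
  ax8  : ∀ α β γ → Axiom ((α ⇒ γ) ⇒ ((β ⇒ γ) ⇒ ((α ∨ β) ⇒ γ)))
  ax9  : ∀ α β   → Axiom ((α ⇒ β) ∨ α)
  ax10 : ∀ α     → Axiom (α ∨ ¬ α)
  bc1  : ∀ α β   → Axiom (∘ α ⇒ (α ⇒ (¬ α ⇒ β)))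

data Justified (Δ : List Formula) : Formula → Set where
  axiom : ∀ {φ}   → Axiom φ → Justified Δ φ
  mp    : ∀ {α β} → α ∈ˡ Δ → (α ⇒ β) ∈ˡ Δ → Justified Δ β
  R¬    : ∀ {α β} → (α ⇔ β) ∈ˡ Δ → Justified Δ (¬ α ⇔ ¬ β)
  R∘    : ∀ {α β} → (α ⇔ β) ∈ˡ Δ → Justified Δ (∘ α ⇔ ∘ β)

-- Derivation sequences are listed in reverse: the head is the last formula,
-- and the tail of each entry consists of the formulas preceding it.
data Derivation : List Formula → Set where
  []  : Derivation []
  _∷_ : ∀ {φ Δ} → Justified Δ φ → Derivation Δ → Derivation (φ ∷ Δ)

infix 3 ⊢_ _⊢_ ⊨_ _⊨_

⊢_ : Formula → Set
⊢ φ = ∃ λ Δ → Derivation (φ ∷ Δ)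

-- foldr₁ associates to the right and does not append a unit:
-- γ₁ ∧ (γ₂ ∧ (⋯ ∧ γₙ)).
_⊢_ : ∀ {ℓ} → Pred Formula ℓ → Formula → Set ℓ
Γ ⊢ φ = (⊢ φ) ⊎ ∃ λ (γs : List⁺ Formula) →
                  All (_∈ Γ) γs × (⊢ (foldr₁ _∧_ γs ⇒ φ))

record Valuation {c ℓ} (B : BALFI c ℓ) : Set (c ⊔ ℓ) where
  private module B = BALFI B
  field
    ⟦_⟧    : Formula → B.Carrier
    ∧-homo : ∀ α β → ⟦ α ∧ β ⟧ B.≈ (⟦ α ⟧ B.∧ ⟦ β ⟧)
    ∨-homo : ∀ α β → ⟦ α ∨ β ⟧ B.≈ (⟦ α ⟧ B.∨ ⟦ β ⟧)
    ⇒-homo : ∀ α β → ⟦ α ⇒ β ⟧ B.≈ (⟦ α ⟧ B.⇒ ⟦ β ⟧)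
    ¬-homo : ∀ α   → ⟦ ¬ α ⟧ B.≈ (B.¬ ⟦ α ⟧)
    ∘-homo : ∀ α   → ⟦ ∘ α ⟧ B.≈ (B.∘ ⟦ α ⟧)

-- Validity over the BALFIs in the lowest universe is the weakest hypothesis
-- for completeness: those in higher universes include lifted copies of them.
⊨_ : Formula → Set₁
⊨ φ = (B : BALFI 0ℓ 0ℓ) (v : Valuation B) →
      let open BALFI B using (_≈_; 1#); open Valuation v in ⟦ φ ⟧ ≈ 1#

_⊨_ : ∀ {ℓ} → Pred Formula ℓ → Formula → Set (lsuc 0ℓ ⊔ ℓ)
Γ ⊨ φ = (⊨ φ) ⊎ ∃ λ (γs : List⁺ Formula) →
          All (_∈ Γ) γs ×
          ((B : BALFI 0ℓ 0ℓ) (v : Valuation B) →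
           let module B = BALFI B; open Valuation v in
           foldr₁ B._∧_ (map ⟦_⟧ γs) B.≤ ⟦ φ ⟧)

{-# OPTIONS --safe #-}

-- Lindenbaum–Tarski argument: formulas up to provable equivalence form a
-- BALFI (the rules R¬ and R∘ are exactly the congruence of ¬ and ∘), and
-- under the identity valuation α has the value 1 iff ⊢ α, and α ≤ β iff
-- ⊢ α ⇒ β.
module Submission where

open import Defs
open import Level using (0ℓ)
open import Data.List.Base using (List; []; _∷_; _++_)
open import Data.List.NonEmpty.Base using (_∷_; foldr₁)
open import Data.List.Properties using (map-id)
open import Data.List.Membership.Propositional.Properties using (∈-++⁺ʳ)
open import Data.List.Relation.Binary.Subset.Propositional using (_⊆_)
open import Data.List.Relation.Binary.Subset.Propositional.Properties
  using (xs⊆xs++ys)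
open import Data.List.Relation.Unary.Any using (here)
open import Data.Product.Base using (_,_)
open import Data.Sum.Base using (inj₁; inj₂)
open import Function.Base using (id)
open import Relation.Binary.Core using (Rel)
open import Relation.Binary.Lattice using (HeytingAlgebra)
open import Relation.Binary.Lattice.Definitions
  using (Exponential; Infimum; Supremum)
open import Relation.Binary.PropositionalEquality using (refl; subst)
open import Relation.Binary.Structures using (IsPartialOrder)
open import Relation.Unary using (Pred)
import Algebra.Lattice.Structures.Biased as BiasedStructures
import Relation.Binary.Lattice.Properties.DistributiveLattice as DistributiveProperties
import Relation.Binary.Lattice.Properties.HeytingAlgebra as HeytingProperties
import Relation.Binary.Lattice.Properties.Lattice as LatticeProperties

private
  variable
    α β γ : Formula
    Δ Θ   : List Formula

Justified-mono : Δ ⊆ Θ → Justified Δ α → Justified Θ α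
Justified-mono s (axiom a) = axiom a
Justified-mono s (mp p q)  = mp (s p) (s q)
Justified-mono s (R¬ p)    = R¬ (s p)
Justified-mono s (R∘ p)    = R∘ (s p)

-- Lists run backwards in time, so `Θ` is derived first. The entries of `Δ` then merely have more
-- formulas preceding them, and `Justified` is monotone in these.
Derivation-++ : Derivation Δ → Derivation Θ → Derivation (Δ ++ Θ)
Derivation-++         []      e = e
Derivation-++ {_ ∷ Δ} (j ∷ d) e =
  Justified-mono (xs⊆xs++ys Δ _) j ∷ Derivation-++ d e

⊢-axiom : Axiom α → ⊢ α
⊢-axiom a = _ , axiom a ∷ []

infixl 5 _·_

_·_ : ⊢ α ⇒ β → ⊢ α → ⊢ β
_·_ {α} {β} (Δ , d) (Θ , e) =
  _ , mp (∈-++⁺ʳ ((α ⇒ β) ∷ Δ) (here refl)) (here refl) ∷ Derivation-++ d e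

⊢-R¬ : ⊢ α ⇔ β → ⊢ ¬ α ⇔ ¬ β
⊢-R¬ (_ , d) = _ , R¬ (here refl) ∷ d

⊢-R∘ : ⊢ α ⇔ β → ⊢ ∘ α ⇔ ∘ β
⊢-R∘ (_ , d) = _ , R∘ (here refl) ∷ d

weaken : ⊢ β → ⊢ α ⇒ β
weaken p = ⊢-axiom (ax1 _ _) · p

-- Together with `weaken` this does the work of a deduction theorem: reasoning below a hypothesis
-- `γ`.
mp-under : ⊢ γ ⇒ (α ⇒ β) → ⊢ γ ⇒ α → ⊢ γ ⇒ β
mp-under p q = ⊢-axiom (ax2 _ _ _) · p · q

⇒-refl : ⊢ α ⇒ α
-- The combinator term S K K.
⇒-refl {α} = mp-under (⊢-axiom (ax1 α (α ⇒ α))) (⊢-axiom (ax1 α α))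

⇒-trans : ⊢ α ⇒ β → ⊢ β ⇒ γ → ⊢ α ⇒ γ
⇒-trans p q = mp-under (weaken q) p

∧-intro : ⊢ α → ⊢ β → ⊢ α ∧ β
∧-intro p q = ⊢-axiom (ax3 _ _) · p · q

∧-proj₁ : ⊢ α ∧ β → ⊢ α
∧-proj₁ p = ⊢-axiom (ax4 _ _) · p

∧-proj₂ : ⊢ α ∧ β → ⊢ β
∧-proj₂ p = ⊢-axiom (ax5 _ _) · p

infix 4 _≈_ _≤_

_≈_ _≤_ : Rel Formula 0ℓ
α ≈ β = ⊢ α ⇔ β
α ≤ β = ⊢ α ⇒ β

≤-isPartialOrder : IsPartialOrder _≈_ _≤_
≤-isPartialOrder = record
  { isPreorder = record
    { isEquivalence = record
      { refl  = ∧-intro ⇒-refl ⇒-refl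
      ; sym   = λ p → ∧-intro (∧-proj₂ p) (∧-proj₁ p)
      ; trans = λ p q → ∧-intro (⇒-trans (∧-proj₁ p) (∧-proj₁ q))
                                (⇒-trans (∧-proj₂ q) (∧-proj₂ p))
      }
    ; reflexive = ∧-proj₁
    ; trans     = ⇒-trans
    }
  ; antisym = ∧-intro
  }

∨-supremum : Supremum _≤_ _∨_
∨-supremum α β =
  ⊢-axiom (ax6 α β) , ⊢-axiom (ax7 α β) ,
  λ γ p q → ⊢-axiom (ax8 α β γ) · p · q

∧-infimum : Infimum _≤_ _∧_
∧-infimum α β =
  ⊢-axiom (ax4 α β) , ⊢-axiom (ax5 α β) ,
  λ γ p q → mp-under (⇒-trans p (⊢-axiom (ax3 α β))) q

⇒-exponential : Exponential _≤_ _∧_ _⇒_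
⇒-exponential γ α β =
  -- Currying: Ax3 forms the pair, and Ax2 on the weakened `p` is postcomposition with `p`.
  (λ p → ⇒-trans (⊢-axiom (ax3 γ α)) (⊢-axiom (ax2 _ _ _) · weaken p)) ,
  (λ p → mp-under (⇒-trans (⊢-axiom (ax4 γ α)) p) (⊢-axiom (ax5 γ α)))

-- bc1, fed with `∘ α`, `α` and `¬ α` projected from the conjunction. It gives both the last BALFI
-- law and a least element.
gentle-explosion : ∀ α β → α ∧ ¬ α ∧ ∘ α ≤ β
gentle-explosion α β =
  mp-under (mp-under (⇒-trans (⇒-trans (⊢-axiom (ax5 _ _)) (⊢-axiom (ax5 _ _)))
                              (⊢-axiom (bc1 α β)))
                     (⊢-axiom (ax4 _ _)))
           (⇒-trans (⊢-axiom (ax5 _ _)) (⊢-axiom (ax4 _ _)))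

-- The signature has no constants, so a theorem and an explosive conjunction stand in for them; the
-- choice of `var 0` is arbitrary.
⊤ ⊥ : Formula
⊤ = var 0 ⇒ var 0
⊥ = var 0 ∧ ¬ var 0 ∧ ∘ var 0

-- Ax1 to Ax8 are positive intuitionistic logic and bc1 supplies the bottom. Distributivity then
-- follows from Heyting algebra theory, with no derivations in the calculus.
heytingAlgebra : HeytingAlgebra 0ℓ 0ℓ 0ℓ
heytingAlgebra = record
  { isHeytingAlgebra = record
    { isBoundedLattice = record
      { isLattice = record
        { isPartialOrder = ≤-isPartialOrder
        ; supremum       = ∨-supremum
        ; infimum        = ∧-infimum
        }
      ; maximum = λ _ → weaken (⇒-refl {var 0})
      ; minimum = gentle-explosion (var 0)
      }
    ; exponential = ⇒-exponential
    }
  }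

open BiasedStructures _≈_ using (isBooleanAlgebraʳ)
open HeytingAlgebra heytingAlgebra
  using (x≤x∨y; y≤x∨y; ∨-least; x∧y≤x; minimum; transpose-⇨; module Eq)
open HeytingProperties heytingAlgebra
  using (⇨-eval; ⇨-applyʳ; ⇨-cong; swap-transpose-⇨; y≤x⇨y;
         distributiveLattice)
open DistributiveProperties distributiveLattice using (∨-distrib-∧; ∧-distrib-∨)
open LatticeProperties (HeytingAlgebra.lattice heytingAlgebra) using (isAlgLattice)

⊢⇒≈⊤ : ⊢ α → α ≈ ⊤
⊢⇒≈⊤ p = ∧-intro (weaken ⇒-refl) (weaken p)

≈⊤⇒⊢ : α ≈ ⊤ → ⊢ α
≈⊤⇒⊢ p = ∧-proj₂ p · ⇒-refl

-- Ax9 with `⊥` as consequent is excluded middle for the Boolean complement `α ⇒ ⊥`; the forward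
-- half argues by cases on it.
⇒-as-∨ : ∀ α β → (α ⇒ β) ≈ ((α ⇒ ⊥) ∨ β)
⇒-as-∨ α β = ∧-intro
  (∨-least (transpose-⇨ (⇒-trans (x∧y≤x _ _) (x≤x∨y _ _)))
           (swap-transpose-⇨ (⇒-trans ⇨-eval (y≤x∨y _ _)))
   · ⊢-axiom (ax9 α ⊥))
  (∨-least (transpose-⇨ (⇒-trans ⇨-eval (minimum β))) y≤x⇨y)

lindenbaum : BALFI 0ℓ 0ℓ
lindenbaum = record
  { Carrier          = Formula
  ; _≈_              = _≈_
  ; _∧_              = _∧_
  ; _∨_              = _∨_
  ; _⇒_              = _⇒_
  ; ¬_               = ¬_
  ; ∘_               = ∘_
  ; 0#               = ⊥
  ; 1#               = ⊤
  ; isBooleanAlgebra = isBooleanAlgebraʳ record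
    { isDistributiveLattice = record
      { isLattice   = isAlgLattice
      ; ∨-distrib-∧ = ∨-distrib-∧
      ; ∧-distrib-∨ = ∧-distrib-∨
      }
    ; ∨-complementʳ = λ α →
        -- Ax9 lists the complement first, so the disjuncts are swapped.
        ⊢⇒≈⊤ (∨-least (y≤x∨y _ _) (x≤x∨y _ _) · ⊢-axiom (ax9 α ⊥))
    ; ∧-complementʳ = λ α → ∧-intro (⇨-applyʳ ⇒-refl) (minimum _)
    -- This concerns the Boolean complement, not the paraconsistent negation, whose congruence is
    -- `⊢-R¬`.
    ; ¬-cong        = λ p → ⇨-cong p Eq.refl
    }
  ; ⇒-def            = ⇒-as-∨
  ; ¬-cong           = ⊢-R¬
  ; ∘-cong           = ⊢-R∘
  ; ∨-¬              = λ α → ⊢⇒≈⊤ (⊢-axiom (ax10 α))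
  ; ∧-¬-∘            = λ α → ∧-intro (gentle-explosion α ⊥) (minimum _)
  }

canonical : Valuation lindenbaum
canonical = record
  { ⟦_⟧    = id
  ; ∧-homo = λ _ _ → Eq.refl
  ; ∨-homo = λ _ _ → Eq.refl
  ; ⇒-homo = λ _ _ → Eq.refl
  ; ¬-homo = λ _ → Eq.refl
  ; ∘-homo = λ _ → Eq.refl
  }

theorem2p15 : ∀ {ℓ} (Γ : Pred Formula ℓ) (φ : Formula) → Γ ⊨ φ → Γ ⊢ φ
theorem2p15 Γ φ (inj₁ valid) = inj₁ (≈⊤⇒⊢ (valid lindenbaum canonical))
theorem2p15 Γ φ (inj₂ (γ ∷ γs , γs⊆Γ , valid)) = inj₂ (γ ∷ γs , γs⊆Γ ,
  -- Under the identity valuation the premises appear as `map id γs`.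
  subst (λ δs → ⊢ foldr₁ _∧_ (γ ∷ δs) ⇒ φ) (map-id γs)
        -- The order of a BALFI is `a ≈ a ∧ b`: its forward half followed by the second projection
        -- is the implication sought.
        (⇒-trans (∧-proj₁ (valid lindenbaum canonical)) (⊢-axiom (ax5 _ _))))
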